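{- If $n\ge 0$ is an integer such that $\deg_t\bigl(B_{n+1}(t)-B_n(t)\bigr)=1$, then $n=1$, and $B_2(t)-B_1(t)=t-1$.
   Context: The Stern polynomials $B_n(t)\in\mathbb{Z}[t]$, $n\ge 0$, are defined by $B_0(t)=0$, $B_1(t)=1$, $B_{2n}(t)=tB_n(t)$ and $B_{2n+1}(t)=B_n(t)+B_{n+1}(t)$ for $n\ge 1$. -}

module Defs where

open import Data.Integer.Base as ℤ using (ℤ; 0ℤ; 1ℤ)
open import Data.List.Base using (List; []; _∷_; map)
open import Data.Nat.Base using (ℕ; zero; suc; _+_; _*_; _<_; z≤n; s≤s)
open import Data.Nat.Induction using (<-rec; <-wellFounded)
open import Data.Nat.Properties
open import Data.Product.Base using (_×_; _,_)
open import Induction.WellFounded using (WfRec; module FixPoint)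
open import Relation.Binary.PropositionalEquality
open import Relation.Nullary.Negation using (contradiction)

-- ℤ[t].  The list a₀ ∷ a₁ ∷ … ∷ aₖ ∷ [] stands for a₀ + a₁ t + … + aₖ tᵏ.
-- Trailing zeros are allowed, so polynomials are compared with _≈_ below,
-- not with _≡_, and the degree is read off the coefficients, not the length.

Poly : Set
Poly = List ℤ

coeff : Poly → ℕ → ℤ
coeff []      _       = 0ℤ
coeff (a ∷ p) zero    = a
coeff (a ∷ p) (suc k) = coeff p k

infix 4 _≈_

_≈_ : Poly → Poly → Set
p ≈ q = ∀ k → coeff p k ≡ coeff q k

0ᵖ 1ᵖ t : Poly
0ᵖ = []
1ᵖ = 1ℤ ∷ []
t  = 0ℤ ∷ 1ℤ ∷ []

infixl 6 _⊕_ _⊖_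
infixr 7 t·_

_⊕_ : Poly → Poly → Poly
[]      ⊕ q       = q
(a ∷ p) ⊕ []      = a ∷ p
(a ∷ p) ⊕ (b ∷ q) = (a ℤ.+ b) ∷ (p ⊕ q)

_⊖_ : Poly → Poly → Poly
p ⊖ q = p ⊕ map ℤ.-_ q

-- Multiplication by t moves every coefficient up by one place.
t·_ : Poly → Poly
t· p = 0ℤ ∷ p

-- "deg p = d" for a natural number d.  The zero polynomial satisfies this
-- for no d.
HasDegree : Poly → ℕ → Set
HasDegree p d = coeff p d ≢ 0ℤ × (∀ k → d < k → coeff p k ≡ 0ℤ)

data Halving (n : ℕ) : Set where
  even : ∀ m → n ≡ 2 * m       → Halving n
  odd  : ∀ m → n ≡ suc (2 * m) → Halving n

halve : ∀ n → Halving n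
halve zero = even 0 refl
halve (suc n) with halve n
... | even m eq = odd m (cong suc eq)
... | odd  m eq = even (suc m) (trans (cong suc eq) (sym (*-suc 2 m)))

even-< : ∀ {n} m → n ≡ 2 * suc m → suc m < n
even-< m refl = m<m+n (suc m) (s≤s z≤n)

odd-<₁ : ∀ {n} m → n ≡ suc (2 * suc m) → suc m < n
odd-<₁ m refl = m<n⇒m<1+n (even-< m refl)

odd-<₂ : ∀ {n} m → n ≡ suc (2 * suc m) → suc (suc m) < n
odd-<₂ m refl = s≤s (even-< m refl)

sternStep : ∀ {n} → Halving n → WfRec _<_ (λ _ → Poly) n → Poly
sternStep (even zero    _)  B = 0ᵖ
sternStep (even (suc m) eq) B = t· B (even-< m eq)
sternStep (odd  zero    _)  B = 1ᵖ
sternStep (odd  (suc m) eq) B = B (odd-<₁ m eq) ⊕ B (odd-<₂ m eq)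

stern : ℕ → Poly
stern = <-rec _ (λ n → sternStep (halve n))

-- The defining recurrences of the Stern polynomials, confirming that the
-- well-founded recursion above computes the intended sequence.

sternStep-ext : ∀ {n} (h : Halving n) {B B′ : WfRec _<_ (λ _ → Poly) n} →
                (∀ {m} (m<n : m < n) → B m<n ≡ B′ m<n) →
                sternStep h B ≡ sternStep h B′
sternStep-ext (even zero    _)  B≡B′ = refl
sternStep-ext (even (suc m) eq) B≡B′ = cong t·_ (B≡B′ (even-< m eq))
sternStep-ext (odd  zero    _)  B≡B′ = refl
sternStep-ext (odd  (suc m) eq) B≡B′ =
  cong₂ _⊕_ (B≡B′ (odd-<₁ m eq)) (B≡B′ (odd-<₂ m eq))

stern-unfold : ∀ n → stern n ≡ sternStep (halve n) (λ {m} _ → stern m)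
stern-unfold n = FixPoint.unfold-wfRec <-wellFounded (λ _ → Poly)
  (λ n → sternStep (halve n)) (λ n → sternStep-ext (halve n)) {n}

stern-0 : stern 0 ≡ 0ᵖ
stern-0 = refl

stern-1 : stern 1 ≡ 1ᵖ
stern-1 = refl

stern-even : ∀ m → stern (2 * suc m) ≡ t· stern (suc m)
stern-even m = trans (stern-unfold (2 * suc m)) (go (halve (2 * suc m)))
  where
  go : (h : Halving (2 * suc m)) →
       sternStep h (λ {k} _ → stern k) ≡ t· stern (suc m)
  go (even zero    eq) = contradiction eq λ ()
  go (even (suc k) eq) = cong (λ j → t· stern j) (sym (*-cancelˡ-≡ (suc m) (suc k) 2 eq))
  go (odd  k       eq) = contradiction eq (even≢odd (suc m) k)

stern-odd : ∀ m → stern (suc (2 * suc m)) ≡ stern (suc m) ⊕ stern (suc (suc m))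
stern-odd m = trans (stern-unfold (suc (2 * suc m))) (go (halve (suc (2 * suc m))))
  where
  go : (h : Halving (suc (2 * suc m))) →
       sternStep h (λ {k} _ → stern k) ≡ stern (suc m) ⊕ stern (suc (suc m))
  go (even k       eq) = contradiction (sym eq) (even≢odd k (suc m))
  go (odd  zero    eq) = contradiction (suc-injective eq) λ ()
  go (odd  (suc k) eq) = cong (λ j → stern j ⊕ stern (suc j))
    (sym (*-cancelˡ-≡ (suc m) (suc k) 2 (suc-injective eq)))

{-# OPTIONS --safe #-}

-- Write Dₙ = Bₙ₊₁ − Bₙ.  One has Bₙ(2) = n, hence Dₙ(2) = 1; and the
-- constant terms of the Bₙ alternate between 0 and 1, so Dₙ(0) = (−1)ⁿ.
-- Suppose Dₙ = a + b t.  For n even, Dₙ(0) = Dₙ(2) forces b = 0.  For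
-- n = 2m + 1, 2 Dₙ(1) = Dₙ(0) + Dₙ(2) = 0, whereas the recurrences give
-- Dₙ(1) = −Bₘ(1).  Since Bₘ(1) > 0 for m > 0, it follows that m = 0.
module Submission where

open import Defs
open import Data.Integer.Base as ℤ using (ℤ; +_; -_; 0ℤ; 1ℤ; -1ℤ; +<+)
import Data.Integer.Properties as ℤ
open import Data.Integer.Tactic.RingSolver using (solve-∀)
open import Data.List.Base using ([]; _∷_; map)
open import Data.Nat.Base using (ℕ; zero; suc; _+_; _*_; _<_; NonZero; z≤n; s≤s)
open import Data.Nat.Induction using (<-rec)
import Data.Nat.Properties as ℕ
open import Data.Product.Base using (_×_; _,_)
open import Relation.Binary.PropositionalEquality
open import Relation.Nullary.Negation using (¬_; contradiction)

open ≡-Reasoning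

eval : ℤ → Poly → ℤ
eval x []      = 0ℤ
eval x (a ∷ p) = a ℤ.+ x ℤ.* eval x p

eval-⊕ : ∀ x p q → eval x (p ⊕ q) ≡ eval x p ℤ.+ eval x q
eval-⊕ x []      q       = sym (ℤ.+-identityˡ _)
eval-⊕ x (a ∷ p) []      = sym (ℤ.+-identityʳ _)
eval-⊕ x (a ∷ p) (b ∷ q) = begin
  (a ℤ.+ b) ℤ.+ x ℤ.* eval x (p ⊕ q)              ≡⟨ cong (λ e → (a ℤ.+ b) ℤ.+ x ℤ.* e) (eval-⊕ x p q) ⟩
  (a ℤ.+ b) ℤ.+ x ℤ.* (eval x p ℤ.+ eval x q)     ≡⟨ regroup a b x (eval x p) (eval x q) ⟩
  (a ℤ.+ x ℤ.* eval x p) ℤ.+ (b ℤ.+ x ℤ.* eval x q) ∎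
  where
  regroup : ∀ a b x u v → (a ℤ.+ b) ℤ.+ x ℤ.* (u ℤ.+ v) ≡ (a ℤ.+ x ℤ.* u) ℤ.+ (b ℤ.+ x ℤ.* v)
  regroup = solve-∀

eval-neg : ∀ x p → eval x (map -_ p) ≡ - eval x p
eval-neg x []      = refl
eval-neg x (a ∷ p) = begin
  - a ℤ.+ x ℤ.* eval x (map -_ p) ≡⟨ cong (λ e → - a ℤ.+ x ℤ.* e) (eval-neg x p) ⟩
  - a ℤ.+ x ℤ.* - eval x p        ≡⟨ factor a x (eval x p) ⟩
  - (a ℤ.+ x ℤ.* eval x p)        ∎
  where
  factor : ∀ a x u → - a ℤ.+ x ℤ.* - u ≡ - (a ℤ.+ x ℤ.* u)
  factor = solve-∀

eval-⊖ : ∀ x p q → eval x (p ⊖ q) ≡ eval x p ℤ.- eval x q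
eval-⊖ x p q = trans (eval-⊕ x p (map -_ q)) (cong (λ e → eval x p ℤ.+ e) (eval-neg x q))

-- Trailing zeros are allowed, so a list `≈ 0ᵖ` need not be empty. This discards the tail of a
-- polynomial above its degree.
eval-≈0 : ∀ x p → p ≈ 0ᵖ → eval x p ≡ 0ℤ
eval-≈0 x []      p≈0 = refl
eval-≈0 x (a ∷ p) p≈0 = begin
  a ℤ.+ x ℤ.* eval x p ≡⟨ cong₂ (λ c e → c ℤ.+ x ℤ.* e) (p≈0 0) (eval-≈0 x p (λ k → p≈0 (suc k))) ⟩
  0ℤ ℤ.+ x ℤ.* 0ℤ      ≡⟨ ℤ.+-identityˡ _ ⟩
  x ℤ.* 0ℤ             ≡⟨ ℤ.*-zeroʳ x ⟩
  0ℤ                   ∎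

-- A list too short to reach the coefficient of `t` has `0ℤ` there, against the degree; in a longer
-- one the entries after the second all vanish.
eval-linear : ∀ p → HasDegree p 1 → ∀ x → eval x p ≡ coeff p 0 ℤ.+ x ℤ.* coeff p 1
eval-linear []          (p₁≢0 , _) x = contradiction refl p₁≢0
eval-linear (a ∷ [])    (p₁≢0 , _) x = contradiction refl p₁≢0
eval-linear (a ∷ b ∷ p) (_ , high) x = cong (λ e → a ℤ.+ x ℤ.* e) (begin
  b ℤ.+ x ℤ.* eval x p ≡⟨ cong (λ e → b ℤ.+ x ℤ.* e) (eval-≈0 x p (λ k → high (suc (suc k)) (s≤s (s≤s z≤n)))) ⟩
  b ℤ.+ x ℤ.* 0ℤ       ≡⟨ cong (λ e → b ℤ.+ e) (ℤ.*-zeroʳ x) ⟩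
  b ℤ.+ 0ℤ             ≡⟨ ℤ.+-identityʳ b ⟩
  b                    ∎)

module _ (x : ℤ) where

  -- After evaluation both recurrences extend to `m = 0`, because `B₀ = 0`; the parity arguments
  -- below then cover small indices uniformly.
  eval-stern-even : ∀ m → eval x (stern (2 * m)) ≡ x ℤ.* eval x (stern m)
  eval-stern-even zero    = sym (ℤ.*-zeroʳ x)
  eval-stern-even (suc m) = trans (cong (eval x) (stern-even m)) (ℤ.+-identityˡ _)

  eval-stern-odd : ∀ m → eval x (stern (suc (2 * m))) ≡ eval x (stern m) ℤ.+ eval x (stern (suc m))
  eval-stern-odd zero    = sym (ℤ.+-identityˡ _)
  eval-stern-odd (suc m) =
    trans (cong (eval x) (stern-odd m)) (eval-⊕ x (stern (suc m)) (stern (suc (suc m))))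

  -- The successor of an odd index arises in this shape, which is not definitionally `2 * suc m`.
  eval-stern-even′ : ∀ m → eval x (stern (suc (suc (2 * m)))) ≡ x ℤ.* eval x (stern (suc m))
  eval-stern-even′ m = trans (cong (λ k → eval x (stern k)) (sym (ℕ.*-suc 2 m))) (eval-stern-even (suc m))

-- Induction along the recurrences. Index 1 is a base case because `m + 1 < 2m + 1` fails at
-- `m = 0`.
stern-induction : (P : ℕ → Set) → P 0 → P 1 →
                  (∀ m → P (suc m) → P (2 * suc m)) →
                  (∀ m → P (suc m) → P (suc (suc m)) → P (suc (2 * suc m))) →
                  ∀ n → P n
stern-induction P P0 P1 Peven Podd = <-rec P λ n → step (halve n)
  where
  step : ∀ {n} → Halving n → (∀ {m} → m < n → P m) → P n
  step (even zero    refl) rec = P0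
  step (even (suc m) refl) rec = Peven m (rec (even-< m refl))
  step (odd  zero    refl) rec = P1
  step (odd  (suc m) refl) rec = Podd m (rec (odd-<₁ m refl)) (rec (odd-<₂ m refl))

-- At `t = 2` the recurrences are those of the identity sequence: `2m = 2 · m` and
-- `2m + 1 = m + (m + 1)`.
eval₂-stern : ∀ n → eval (+ 2) (stern n) ≡ + n
eval₂-stern = stern-induction _ refl refl
  (λ m ih → begin
    eval (+ 2) (stern (2 * suc m))       ≡⟨ eval-stern-even (+ 2) (suc m) ⟩
    + 2 ℤ.* eval (+ 2) (stern (suc m))   ≡⟨ cong (+ 2 ℤ.*_) ih ⟩
    + 2 ℤ.* + suc m                      ≡⟨ ℤ.pos-* 2 (suc m) ⟨
    + (2 * suc m)                        ∎)
  (λ m ih ih′ → begin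
    eval (+ 2) (stern (suc (2 * suc m))) ≡⟨ eval-stern-odd (+ 2) (suc m) ⟩
    eval (+ 2) (stern (suc m)) ℤ.+ eval (+ 2) (stern (suc (suc m)))
                                         ≡⟨ cong₂ ℤ._+_ ih ih′ ⟩
    + (suc m + suc (suc m))              ≡⟨ cong +_ (ℕ.+-suc (suc m) (suc m)) ⟩
    + suc (suc m + suc m)                ≡⟨ cong (λ k → + suc (suc m + k)) (ℕ.+-identityʳ (suc m)) ⟨
    + suc (2 * suc m)                    ∎)

-- At `t = 1` this is Stern's diatomic sequence, whose recurrences only copy and add earlier
-- positive terms.
eval₁-stern-positive : ∀ n → .{{NonZero n}} → 0ℤ ℤ.< eval 1ℤ (stern n)
eval₁-stern-positive = stern-induction (λ n → .{{NonZero n}} → 0ℤ ℤ.< eval 1ℤ (stern n))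
  (λ {{}})
  (+<+ (s≤s z≤n))
  (λ m ih → subst (0ℤ ℤ.<_) (sym (trans (eval-stern-even 1ℤ (suc m)) (ℤ.*-identityˡ _))) ih)
  (λ m ih ih′ → subst (0ℤ ℤ.<_) (sym (eval-stern-odd 1ℤ (suc m))) (ℤ.+-mono-< ih ih′))

eval₁-stern≡0⇒≡0 : ∀ n → eval 1ℤ (stern n) ≡ 0ℤ → n ≡ 0
eval₁-stern≡0⇒≡0 zero    _  = refl
eval₁-stern≡0⇒≡0 (suc n) eq = contradiction (sym eq) (ℤ.<⇒≢ (eval₁-stern-positive (suc n)))

-- At `t = 0` even-indexed terms vanish and the term at `2m + 1` is the sum for the pair at `m`, so
-- the sum of neighbours is an invariant.
eval₀-stern-consecutive : ∀ n → eval 0ℤ (stern n) ℤ.+ eval 0ℤ (stern (suc n)) ≡ 1ℤ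
eval₀-stern-consecutive = stern-induction _ refl refl
  (λ m ih → trans (cong₂ ℤ._+_ (eval-stern-even 0ℤ (suc m)) (eval-stern-odd 0ℤ (suc m)))
                  (trans (ℤ.+-identityˡ _) ih))
  (λ m ih _ → trans (cong₂ ℤ._+_ (eval-stern-odd 0ℤ (suc m)) (eval-stern-even′ 0ℤ (suc m)))
                    (trans (ℤ.+-identityʳ _) ih))

Δ : ℕ → Poly
Δ n = stern (suc n) ⊖ stern n

eval-Δ : ∀ x n → eval x (Δ n) ≡ eval x (stern (suc n)) ℤ.- eval x (stern n)
eval-Δ x n = eval-⊖ x (stern (suc n)) (stern n)

eval₂-Δ : ∀ n → eval (+ 2) (Δ n) ≡ 1ℤ
eval₂-Δ n = begin
  eval (+ 2) (Δ n)       ≡⟨ eval-Δ (+ 2) n ⟩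
  eval (+ 2) (stern (suc n)) ℤ.- eval (+ 2) (stern n)
                         ≡⟨ cong₂ ℤ._-_ (eval₂-stern (suc n)) (eval₂-stern n) ⟩
  -- `+ suc n` is definitionally `1ℤ ℤ.+ + n`, which exposes `+ n` to the ring identity.
  (1ℤ ℤ.+ + n) ℤ.- + n   ≡⟨ cancel (+ n) ⟩
  1ℤ                     ∎
  where
  cancel : ∀ i → (1ℤ ℤ.+ i) ℤ.- i ≡ 1ℤ
  cancel = solve-∀

eval₀-Δ-even : ∀ m → eval 0ℤ (Δ (2 * m)) ≡ 1ℤ
eval₀-Δ-even m = begin
  eval 0ℤ (Δ (2 * m)) ≡⟨ eval-Δ 0ℤ (2 * m) ⟩
  eval 0ℤ (stern (suc (2 * m))) ℤ.- eval 0ℤ (stern (2 * m))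
    ≡⟨ cong₂ ℤ._-_ (trans (eval-stern-odd 0ℤ m) (eval₀-stern-consecutive m)) (eval-stern-even 0ℤ m) ⟩
  -- The subtracted term has the factor `0ℤ` and disappears by computation.
  1ℤ                  ∎

eval₀-Δ-odd : ∀ m → eval 0ℤ (Δ (suc (2 * m))) ≡ -1ℤ
eval₀-Δ-odd m = begin
  eval 0ℤ (Δ (suc (2 * m))) ≡⟨ eval-Δ 0ℤ (suc (2 * m)) ⟩
  eval 0ℤ (stern (suc (suc (2 * m)))) ℤ.- eval 0ℤ (stern (suc (2 * m)))
    ≡⟨ cong₂ ℤ._-_ (eval-stern-even′ 0ℤ m) (trans (eval-stern-odd 0ℤ m) (eval₀-stern-consecutive m)) ⟩
  -1ℤ                       ∎

-- At `t = 1`, `B₂ₘ₊₂` equals `Bₘ₊₁`, which is also a summand of `B₂ₘ₊₁` and cancels.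
eval₁-Δ-odd : ∀ m → eval 1ℤ (Δ (suc (2 * m))) ≡ - eval 1ℤ (stern m)
eval₁-Δ-odd m = begin
  eval 1ℤ (Δ (suc (2 * m)))                         ≡⟨ eval-Δ 1ℤ (suc (2 * m)) ⟩
  eval 1ℤ (stern (suc (suc (2 * m)))) ℤ.- eval 1ℤ (stern (suc (2 * m)))
    ≡⟨ cong₂ ℤ._-_ (eval-stern-even′ 1ℤ m) (eval-stern-odd 1ℤ m) ⟩
  1ℤ ℤ.* eval 1ℤ (stern (suc m)) ℤ.- (eval 1ℤ (stern m) ℤ.+ eval 1ℤ (stern (suc m)))
    ≡⟨ cancel (eval 1ℤ (stern m)) (eval 1ℤ (stern (suc m))) ⟩
  - eval 1ℤ (stern m)                               ∎
  where
  cancel : ∀ i j → 1ℤ ℤ.* j ℤ.- (i ℤ.+ j) ≡ - i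
  cancel = solve-∀

-- The two values differ by twice the leading coefficient.
degree-one⇒eval₀≢eval₂ : ∀ p → HasDegree p 1 → eval 0ℤ p ≢ eval (+ 2) p
degree-one⇒eval₀≢eval₂ p deg@(p₁≢0 , _) eq =
  p₁≢0 (ℤ.*-cancelˡ-≡ (+ 2) b 0ℤ (begin
    + 2 ℤ.* b                               ≡⟨ difference a b ⟩
    (a ℤ.+ + 2 ℤ.* b) ℤ.- (a ℤ.+ 0ℤ ℤ.* b)  ≡⟨ cong₂ ℤ._-_ (eval-linear p deg (+ 2)) (eval-linear p deg 0ℤ) ⟨
    eval (+ 2) p ℤ.- eval 0ℤ p              ≡⟨ ℤ.i≡j⇒i-j≡0 (sym eq) ⟩
    0ℤ                                      ∎))
  where
  a b : ℤ
  a = coeff p 0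
  b = coeff p 1
  difference : ∀ a b → + 2 ℤ.* b ≡ (a ℤ.+ + 2 ℤ.* b) ℤ.- (a ℤ.+ 0ℤ ℤ.* b)
  difference = solve-∀

-- A linear function takes at the midpoint 1 the mean of its values at 0 and 2; doubling avoids
-- division in ℤ.
degree-one⇒2*eval₁ : ∀ p → HasDegree p 1 → + 2 ℤ.* eval 1ℤ p ≡ eval 0ℤ p ℤ.+ eval (+ 2) p
degree-one⇒2*eval₁ p deg = begin
  + 2 ℤ.* eval 1ℤ p                       ≡⟨ cong (+ 2 ℤ.*_) (eval-linear p deg 1ℤ) ⟩
  + 2 ℤ.* (a ℤ.+ 1ℤ ℤ.* b)                ≡⟨ midpoint a b ⟩
  (a ℤ.+ 0ℤ ℤ.* b) ℤ.+ (a ℤ.+ + 2 ℤ.* b)  ≡⟨ cong₂ ℤ._+_ (eval-linear p deg 0ℤ) (eval-linear p deg (+ 2)) ⟨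
  eval 0ℤ p ℤ.+ eval (+ 2) p              ∎
  where
  a b : ℤ
  a = coeff p 0
  b = coeff p 1
  midpoint : ∀ a b → + 2 ℤ.* (a ℤ.+ 1ℤ ℤ.* b) ≡ (a ℤ.+ 0ℤ ℤ.* b) ℤ.+ (a ℤ.+ + 2 ℤ.* b)
  midpoint = solve-∀

Δ-even-¬degree-one : ∀ m → ¬ HasDegree (Δ (2 * m)) 1
Δ-even-¬degree-one m deg = degree-one⇒eval₀≢eval₂ (Δ (2 * m)) deg
  (trans (eval₀-Δ-even m) (sym (eval₂-Δ (2 * m))))

Δ-odd-degree-one⇒≡0 : ∀ m → HasDegree (Δ (suc (2 * m))) 1 → m ≡ 0
Δ-odd-degree-one⇒≡0 m deg = eval₁-stern≡0⇒≡0 m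
  -- Twice the value at 1 is `-1ℤ ℤ.+ 1ℤ`; cancelling 2 and then the sign leaves `Bₘ(1) = 0`.
  (ℤ.neg-injective (trans (sym (eval₁-Δ-odd m)) (ℤ.*-cancelˡ-≡ (+ 2) _ 0ℤ (begin
    + 2 ℤ.* eval 1ℤ (Δ n)              ≡⟨ degree-one⇒2*eval₁ (Δ n) deg ⟩
    eval 0ℤ (Δ n) ℤ.+ eval (+ 2) (Δ n) ≡⟨ cong₂ ℤ._+_ (eval₀-Δ-odd m) (eval₂-Δ n) ⟩
    0ℤ                                 ∎))))
  where
  n : ℕ
  n = suc (2 * m)

-- With the `Halving` as an argument, matching on `refl` replaces `n` by its even or odd form
-- throughout the goal.
Δ-degree-one⇒≡1 : ∀ n → Halving n → HasDegree (Δ n) 1 → n ≡ 1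
Δ-degree-one⇒≡1 n (even m refl) deg = contradiction deg (Δ-even-¬degree-one m)
Δ-degree-one⇒≡1 n (odd  m refl) deg = cong (λ k → suc (2 * k)) (Δ-odd-degree-one⇒≡0 m deg)

theorem5p4 : (∀ (n : ℕ) → HasDegree (stern (suc n) ⊖ stern n) 1 → n ≡ 1)
    × (stern 2 ⊖ stern 1 ≈ t ⊖ 1ᵖ)
-- In the second component both sides compute to the list `-1ℤ ∷ 1ℤ ∷ []`.
theorem5p4 = (λ n → Δ-degree-one⇒≡1 n (halve n)) , λ _ → refl
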